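{- Let $S$ be an abelian semigroup (written additively, containing an identity element $0$), let $r \geq 1$, and let $A_1,\ldots,A_r, B$ be finite, nonempty subsets of $S$. Then there exists a polynomial $p(z_1,\ldots,z_r)$ such that \[ |B + h_1A_1 + \cdots + h_rA_r| = p(h_1,\ldots,h_r) \] for all nonnegative integers $h_1,\ldots,h_r$ with $\min(h_1,\ldots,h_r)$ sufficiently large.
   Context: For a nonempty subset $A$ of $S$ and a positive integer $h$, $hA$ denotes the set of all sums of $h$ not necessarily distinct elements of $A$, and $0A = \{0\}$. For nonempty subsets $A_1,\ldots,A_r,B$ of $S$ and nonnegative integers $h_1,\ldots,h_r$, $B + h_1A_1 + \cdots + h_rA_r$ denotes the set of all elements of $S$ of the form $b + u_1 + \cdots + u_r$ with $b \in B$ and $u_i \in h_iA_i$ for each $i$. $|X|$ denotes the cardinality of a set $X$. -}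

module Defs where

open import Algebra.Bundles using (CommutativeMonoid)
open import Data.Fin.Base using (Fin)
open import Data.Integer.Base using (+_)
open import Data.List.Base as List using (List)
open import Data.Nat.Base using (ℕ; suc; _⊓_; NonZero)
open import Data.Product.Base using (Σ; ∃; ∃-syntax; _×_; _,_; proj₁)
open import Data.Rational.Base using (ℚ; 0ℚ; _+_; _*_; _/_; +-*-rawSemiring)
open import Data.Vec.Functional using (Vector; head; tail; foldr)
open import Function.Bundles using (Bijection)
open import Level using (_⊔_)
open import Relation.Binary.Bundles using (Setoid)
import Relation.Binary.Construct.On as On
import Relation.Binary.PropositionalEquality.Properties as ≡
open import Relation.Unary using (Pred; _∈_)
open import Algebra.Definitions.RawSemiring +-*-rawSemiring using (_^_; product)

min : ∀ {r} .{{_ : NonZero r}} → Vector ℕ r → ℕ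
min {suc _} h = foldr _⊓_ (head h) (tail h)

-- A polynomial in r variables is a finite formal sum of terms c·z₁^e₁⋯zᵣ^eᵣ,
-- each given by its coefficient and exponent vector. Terms with equal exponents
-- may repeat, so distinct lists can denote the same polynomial.
Polynomial : ℕ → Set
Polynomial r = List (ℚ × Vector ℕ r)

evalTerm : ∀ {r} → ℚ × Vector ℕ r → Vector ℚ r → ℚ
evalTerm (c , e) z = c * product (λ i → z i ^ e i)

eval : ∀ {r} → Polynomial r → Vector ℚ r → ℚ
eval p z = List.foldr (λ t s → evalTerm t z + s) 0ℚ p

fromℕ : ℕ → ℚ
fromℕ n = + n / 1

module Cardinality {c ℓ} (S : Setoid c ℓ) where
  open Setoid S using (Carrier)

  -- X has exactly n elements, counted up to the equality of S.
  HasCard : ∀ {p} → Pred Carrier p → ℕ → Set (c ⊔ ℓ ⊔ p)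
  HasCard X n = Bijection (≡.setoid (Fin n)) (On.setoid {B = Σ Carrier X} S proj₁)

  Finite : ∀ {p} → Pred Carrier p → Set (c ⊔ ℓ ⊔ p)
  Finite X = ∃ (HasCard X)

module Sumsets {c ℓ} (M : CommutativeMonoid c ℓ) where
  open CommutativeMonoid M using (Carrier; _≈_; _∙_; rawMonoid)
  open import Algebra.Definitions.RawMonoid rawMonoid using (sum)

  -- The case h = 0 gives { 0 }, the empty sum being the identity.
  _·_ : ∀ {p} → ℕ → Pred Carrier p → Pred Carrier (c ⊔ ℓ ⊔ p)
  (h · A) x = ∃[ a ] (∀ j → a j ∈ A) × x ≈ sum {h} a

  sumset : ∀ {p r} → Pred Carrier p → Vector ℕ r → Vector (Pred Carrier p) r →
           Pred Carrier (c ⊔ ℓ ⊔ p)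
  sumset B h A x =
    ∃[ b ] ∃[ u ] b ∈ B × (∀ i → u i ∈ h i · A i) × x ≈ b ∙ sum u

{-# OPTIONS --safe #-}

-- Adjoin B as a further summand with multiplicity 1, so that the sumset is the
-- image of the vectors x of natural numbers (one coordinate per element of B and
-- of the Aᵢ) whose multidegree is (1 , h). Call x irreducible if no
-- lexicographically smaller vector has the same degree and the same image. Each
-- element of the sumset has exactly one irreducible representative, and since the
-- order is translation invariant the irreducible vectors form a down-set. Slicing
-- a down-set along a coordinate of colour i gives a decreasing family of
-- down-sets, which stabilises; hence, by induction on the number of coordinates,
-- the generating function counting its elements by degree is a finite sum of terms
-- ∏ zᵢ^aᵢ / (1 − zᵢ)^eᵢ. Its coefficients are sums of products of
-- one-variable functions, each eventually a polynomial; this remains so after fixing the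
-- degree of the adjoined summand to 1.
module Submission where

open import Algebra.Bundles using (CommutativeMonoid)
open import Axiom.ExcludedMiddle using (ExcludedMiddle)
open import Data.Bool.Base using (true; false)
open import Data.Fin.Base using (Fin; zero; suc)
import Data.Fin.Properties as Fin
import Data.Integer.Base as ℤ
import Data.Integer.Properties as ℤ
open import Data.List.Base as List using (List; []; _∷_; _++_; filter; length)
open import Data.List.Membership.Propositional using () renaming (_∈_ to _∈ˡ_)
open import Data.List.Membership.Propositional.Properties using (∈-map⁺; ∈-map⁻; ∈-++⁺ˡ; ∈-++⁺ʳ; ∈-++⁻; ∈-filter⁺; ∈-filter⁻; ∈-lookup)
import Data.List.Properties as List
open import Data.List.Relation.Unary.All as All using (All; []; _∷_)
import Data.List.Relation.Unary.All.Properties as All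
open import Data.List.Relation.Unary.AllPairs using ([]; _∷_)
open import Data.List.Relation.Unary.Any as Any using (Any; here; there)
import Data.List.Relation.Unary.Any.Properties as Any
open import Data.List.Relation.Unary.Unique.Propositional using (Unique)
import Data.List.Relation.Unary.Unique.Propositional.Properties as Unique
open import Data.Nat.Base as ℕ using (ℕ; zero; suc; _+_; _*_; _⊓_; _≤_; _<_; z≤n; s≤s; NonZero)
open import Data.Nat.Induction using (<-wellFounded)
import Data.Nat.ListAction as ListAction
import Data.Nat.Properties as ℕ
open import Data.Nat.Tactic.RingSolver using (solve-∀)
open import Data.Product.Base using (Σ-syntax; ∃; ∃-syntax; _×_; _,_; proj₁; proj₂; map₁; map₂)
open import Data.Rational.Base as ℚ using (ℚ; 0ℚ; 1ℚ; +-*-rawSemiring)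
import Data.Rational.Properties as ℚ
open import Data.Rational.Solver using (module +-*-Solver)
import Data.Rational.Unnormalised.Base as ℚᵘ
import Data.Rational.Unnormalised.Properties as ℚᵘ
open import Data.Sum.Base using (inj₁; inj₂)
open import Data.Vec.Base as Vec using (Vec; []; _∷_; zipWith)
open import Data.Vec.Functional as Vector using (Vector; replicate; updateAt; tail)
open import Data.Vec.Functional.Properties using (updateAt-updates; updateAt-minimal; updateAt-id-local)
open import Data.Vec.Relation.Binary.Lex.Strict as Lex using (Lex-<; this; next)
open import Data.Vec.Relation.Binary.Pointwise.Inductive as Pointwise using (Pointwise; []; _∷_)
open import Function.Base using (_∘_; const)
open import Function.Bundles using (Bijection)
open import Induction.WellFounded using (WellFounded; Acc; acc)
open import Level using (Level; Lift; lift; lower; _⊔_)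
open import Relation.Binary.Definitions using (_Respects_; tri<; tri≈; tri>)
open import Relation.Binary.PropositionalEquality using (_≡_; _≗_; refl; sym; trans; cong; cong₂; subst; subst₂; module ≡-Reasoning)
open import Relation.Nullary using (¬_; yes; no; does; contradiction)
open import Relation.Nullary.Decidable using (decidable-stable; map′)
open import Relation.Unary using (Pred; Satisfiable; _∈_; _≐_)
open import Algebra.Definitions.RawSemiring +-*-rawSemiring using (_^_; product)
import Algebra.Properties.CommutativeMonoid.Sum ℚ.*-1-commutativeMonoid as Product
import Algebra.Properties.Monoid.Mult ℚ.*-1-monoid as Power
open import Algebra.Properties.CommutativeMonoid.Sum ℕ.*-1-commutativeMonoid using () renaming (sum to ∏; sum-cong-≗ to ∏-cong)
open import Algebra.Properties.CommutativeMonoid.Sum ℕ.+-0-commutativeMonoid using () renaming (sum to ∑; sum-replicate-zero to ∑-replicate-zero)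
open import Algebra.Properties.CommutativeSemigroup ℕ.+-commutativeSemigroup using () renaming (interchange to +-interchange)
open import Defs

private variable
  ℓ : Level
  k R : ℕ

-- Finite sums with one entry changed, and the embedding of ℕ in ℚ.

module _ {c ℓ} (M : CommutativeMonoid c ℓ) where
  open CommutativeMonoid M renaming (refl to ≈-refl; sym to ≈-sym; trans to ≈-trans)
  open import Algebra.Properties.CommutativeMonoid.Sum M using (sum)
  open import Algebra.Properties.CommutativeSemigroup commutativeSemigroup using (x∙yz≈y∙xz)

  -- Serves twice: in the multiplicative monoid of `ℚ` for monomials, and in S for regrouping
  -- generators by summand.
  sum-updateAt : ∀ {n} (u : Vector Carrier n) i x →
                 sum (updateAt u i (x ∙_)) ≈ x ∙ sum u
  sum-updateAt u zero    x = assoc _ _ _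
  sum-updateAt u (suc i) x =
    ≈-trans (∙-congˡ (sum-updateAt (tail u) i x)) (x∙yz≈y∙xz _ _ _)

-- Operations on `ℚ` reduce to lowest terms and are stuck on variables; after `toℚᵘ` the claim is an
-- identity of fractions with denominator 1.
fromℕ-+ : ∀ m n → fromℕ (m + n) ≡ fromℕ m ℚ.+ fromℕ n
fromℕ-+ m n = ℚ.toℚᵘ-injective (begin
  ℚ.toℚᵘ (fromℕ (m + n))                    ≈⟨ ℚ.toℚᵘ-fromℚᵘ (ℚᵘ.mkℚᵘ (ℤ.+ (m + n)) 0) ⟩
  ℚᵘ.mkℚᵘ (ℤ.+ (m + n)) 0
    ≈⟨ ℚᵘ.*≡* (cong (ℤ._* ℤ.+ 1) (cong₂ ℤ._+_ (ℤ.*-identityʳ (ℤ.+ m)) (ℤ.*-identityʳ (ℤ.+ n)))) ⟨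
  ℚᵘ.mkℚᵘ (ℤ.+ m) 0 ℚᵘ.+ ℚᵘ.mkℚᵘ (ℤ.+ n) 0
    ≈⟨ ℚᵘ.+-cong (ℚ.toℚᵘ-fromℚᵘ (ℚᵘ.mkℚᵘ (ℤ.+ m) 0)) (ℚ.toℚᵘ-fromℚᵘ (ℚᵘ.mkℚᵘ (ℤ.+ n) 0)) ⟨
  ℚ.toℚᵘ (fromℕ m) ℚᵘ.+ ℚ.toℚᵘ (fromℕ n)    ≈⟨ ℚ.toℚᵘ-homo-+ (fromℕ m) (fromℕ n) ⟨
  ℚ.toℚᵘ (fromℕ m ℚ.+ fromℕ n)              ∎)
  where open import Relation.Binary.Reasoning.Setoid ℚᵘ.≃-setoid

fromℕ-* : ∀ m n → fromℕ (m * n) ≡ fromℕ m ℚ.* fromℕ n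
fromℕ-* m n = ℚ.toℚᵘ-injective (begin
  ℚ.toℚᵘ (fromℕ (m * n))                    ≈⟨ ℚ.toℚᵘ-fromℚᵘ (ℚᵘ.mkℚᵘ (ℤ.+ (m * n)) 0) ⟩
  ℚᵘ.mkℚᵘ (ℤ.+ (m * n)) 0                     ≈⟨ ℚᵘ.*≡* (cong (ℤ._* ℤ.+ 1) (ℤ.pos-* m n)) ⟩
  ℚᵘ.mkℚᵘ (ℤ.+ m) 0 ℚᵘ.* ℚᵘ.mkℚᵘ (ℤ.+ n) 0
    ≈⟨ ℚᵘ.*-cong (ℚ.toℚᵘ-fromℚᵘ (ℚᵘ.mkℚᵘ (ℤ.+ m) 0)) (ℚ.toℚᵘ-fromℚᵘ (ℚᵘ.mkℚᵘ (ℤ.+ n) 0)) ⟨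
  ℚ.toℚᵘ (fromℕ m) ℚᵘ.* ℚ.toℚᵘ (fromℕ n)    ≈⟨ ℚ.toℚᵘ-homo-* (fromℕ m) (fromℕ n) ⟨
  ℚ.toℚᵘ (fromℕ m ℚ.* fromℕ n)              ∎)
  where open import Relation.Binary.Reasoning.Setoid ℚᵘ.≃-setoid

1/1+_ : ℕ → ℚ
1/1+ n = ℤ.+ 1 ℚ./ suc n

1/1+-inverse : ∀ n → 1/1+ n ℚ.* fromℕ (suc n) ≡ 1ℚ
1/1+-inverse n = ℚ.toℚᵘ-injective (begin
  ℚ.toℚᵘ (1/1+ n ℚ.* fromℕ (suc n))              ≈⟨ ℚ.toℚᵘ-homo-* (1/1+ n) (fromℕ (suc n)) ⟩
  ℚ.toℚᵘ (1/1+ n) ℚᵘ.* ℚ.toℚᵘ (fromℕ (suc n))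
    ≈⟨ ℚᵘ.*-cong (ℚ.toℚᵘ-fromℚᵘ (ℚᵘ.mkℚᵘ (ℤ.+ 1) n)) (ℚ.toℚᵘ-fromℚᵘ (ℚᵘ.mkℚᵘ (ℤ.+ suc n) 0)) ⟩
  ℚᵘ.mkℚᵘ (ℤ.+ 1) n ℚᵘ.* ℚᵘ.mkℚᵘ (ℤ.+ suc n) 0       ≈⟨ ℚᵘ.*-inverseˡ (ℚᵘ.mkℚᵘ (ℤ.+ suc n) 0) ⟩
  ℚᵘ.1ℚᵘ                                         ∎)
  where open import Relation.Binary.Reasoning.Setoid ℚᵘ.≃-setoid

-- Polynomial functions and their closure properties.

IsPolynomial : ∀ {r} → (Vector ℚ r → ℚ) → Set
IsPolynomial {r} f = Σ[ P ∈ Polynomial r ] (∀ z → eval P z ≡ f z)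

module _ {r : ℕ} where

  eval-++ : ∀ (P Q : Polynomial r) z → eval (P ++ Q) z ≡ eval P z ℚ.+ eval Q z
  eval-++ []      Q z = sym (ℚ.+-identityˡ _)
  eval-++ (t ∷ P) Q z = trans (cong (evalTerm t z ℚ.+_) (eval-++ P Q z)) (sym (ℚ.+-assoc (evalTerm t z) _ _))

  mulTerm : ℚ × Vector ℕ r → ℚ × Vector ℕ r → ℚ × Vector ℕ r
  mulTerm (c , e) (d , f) = c ℚ.* d , λ i → e i + f i

  evalTerm-mul : ∀ s t z → evalTerm (mulTerm s t) z ≡ evalTerm s z ℚ.* evalTerm t z
  evalTerm-mul (c , e) (d , f) z = begin
    c ℚ.* d ℚ.* product (λ i → z i ^ (e i + f i))
      ≡⟨ cong (c ℚ.* d ℚ.*_) (Product.sum-cong-≗ λ i → Power.×-homo-+ (z i) (e i) (f i)) ⟩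
    c ℚ.* d ℚ.* product (λ i → z i ^ e i ℚ.* z i ^ f i)
      ≡⟨ cong (c ℚ.* d ℚ.*_) (Product.∑-distrib-+ (λ i → z i ^ e i) (λ i → z i ^ f i)) ⟩
    c ℚ.* d ℚ.* (product (λ i → z i ^ e i) ℚ.* product (λ i → z i ^ f i))
      ≡⟨ solve 4 (λ c d x y → c :* d :* (x :* y) := c :* x :* (d :* y)) refl c d _ _ ⟩
    evalTerm (c , e) z ℚ.* evalTerm (d , f) z ∎
    where
    open ≡-Reasoning
    open +-*-Solver

  eval-mulTerm : ∀ t (P : Polynomial r) z →
                 eval (List.map (mulTerm t) P) z ≡ evalTerm t z ℚ.* eval P z
  eval-mulTerm t []      z = sym (ℚ.*-zeroʳ (evalTerm t z))
  eval-mulTerm t (s ∷ P) z = trans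
    (cong₂ ℚ._+_ (evalTerm-mul t s z) (eval-mulTerm t P z))
    (sym (ℚ.*-distribˡ-+ (evalTerm t z) _ _))

  mul : Polynomial r → Polynomial r → Polynomial r
  mul []      Q = []
  mul (t ∷ P) Q = List.map (mulTerm t) Q ++ mul P Q

  eval-mul : ∀ P Q z → eval (mul P Q) z ≡ eval P z ℚ.* eval Q z
  eval-mul []      Q z = sym (ℚ.*-zeroˡ (eval Q z))
  eval-mul (t ∷ P) Q z = begin
    eval (List.map (mulTerm t) Q ++ mul P Q) z
      ≡⟨ eval-++ (List.map (mulTerm t) Q) (mul P Q) z ⟩
    eval (List.map (mulTerm t) Q) z ℚ.+ eval (mul P Q) z
      ≡⟨ cong₂ ℚ._+_ (eval-mulTerm t Q z) (eval-mul P Q z) ⟩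
    evalTerm t z ℚ.* eval Q z ℚ.+ eval P z ℚ.* eval Q z
      ≡⟨ ℚ.*-distribʳ-+ (eval Q z) (evalTerm t z) (eval P z) ⟨
    eval (t ∷ P) z ℚ.* eval Q z ∎
    where open ≡-Reasoning

  +-isPolynomial : {f g : Vector ℚ r → ℚ} → IsPolynomial f → IsPolynomial g →
                   IsPolynomial (λ z → f z ℚ.+ g z)
  +-isPolynomial (P , p) (Q , q) = P ++ Q , λ z → trans (eval-++ P Q z) (cong₂ ℚ._+_ (p z) (q z))

  *-isPolynomial : {f g : Vector ℚ r → ℚ} → IsPolynomial f → IsPolynomial g →
                   IsPolynomial (λ z → f z ℚ.* g z)
  *-isPolynomial (P , p) (Q , q) = mul P Q , λ z → trans (eval-mul P Q z) (cong₂ ℚ._*_ (p z) (q z))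

  const-isPolynomial : ∀ c → IsPolynomial {r} (λ _ → c)
  const-isPolynomial c = (c , replicate r 0) ∷ [] , λ z → begin
    c ℚ.* product (replicate r 1ℚ) ℚ.+ 0ℚ  ≡⟨ ℚ.+-identityʳ _ ⟩
    c ℚ.* product (replicate r 1ℚ)         ≡⟨ cong (c ℚ.*_) (Product.sum-replicate-zero r) ⟩
    c ℚ.* 1ℚ                               ≡⟨ ℚ.*-identityʳ c ⟩
    c                                      ∎
    where open ≡-Reasoning

-- Raising one exponent multiplies one factor of the monomial by `z i`, which brings the product
-- into the form treated by `sum-updateAt`.
^-updateAt : ∀ {r} (z : Vector ℚ r) (e : Vector ℕ r) i j →
             z j ^ updateAt e i suc j ≡ updateAt (λ j → z j ^ e j) i (z i ℚ.*_) j
^-updateAt z e zero    zero    = refl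
^-updateAt z e zero    (suc j) = refl
^-updateAt z e (suc i) zero    = refl
^-updateAt z e (suc i) (suc j) = ^-updateAt (tail z) (tail e) i j

var-isPolynomial : ∀ {r} (i : Fin r) → IsPolynomial (λ z → z i)
var-isPolynomial {r} i = (1ℚ , updateAt (replicate r 0) i suc) ∷ [] , λ z → begin
  1ℚ ℚ.* product (λ j → z j ^ updateAt (replicate r 0) i suc j) ℚ.+ 0ℚ
    ≡⟨ trans (ℚ.+-identityʳ _) (ℚ.*-identityˡ _) ⟩
  product (λ j → z j ^ updateAt (replicate r 0) i suc j)
    ≡⟨ Product.sum-cong-≗ (^-updateAt z (replicate r 0) i) ⟩
  product (updateAt (replicate r 1ℚ) i (z i ℚ.*_))
    ≡⟨ sum-updateAt ℚ.*-1-commutativeMonoid (replicate r 1ℚ) i (z i) ⟩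
  z i ℚ.* product (replicate r 1ℚ)
    ≡⟨ cong (z i ℚ.*_) (Product.sum-replicate-zero r) ⟩
  z i ℚ.* 1ℚ
    ≡⟨ ℚ.*-identityʳ (z i) ⟩
  z i ∎
  where open ≡-Reasoning

-- The coefficients of zᵃ / (1 - z)ᵉ.

-- coeff a e n is the coefficient of zⁿ in zᵃ / (1 − z)ᵉ.
coeff : ℕ → ℕ → ℕ → ℕ
coeff zero    zero    zero    = 1
coeff zero    zero    (suc n) = 0
coeff zero    (suc e) zero    = coeff 0 e 0
coeff zero    (suc e) (suc n) = coeff 0 e (suc n) + coeff 0 (suc e) n
coeff (suc a) e       zero    = 0
coeff (suc a) e       (suc n) = coeff a e n

-- Compares coefficients in zᵃ / (1 - z)ᵉ = (1 - z) · zᵃ / (1 - z)ᵉ⁺¹. The definition builds this in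
-- for a = 0 only; a positive a delays it.
coeff-suc-suc : ∀ a e n → coeff a (suc e) (suc n) ≡ coeff a e (suc n) + coeff a (suc e) n
coeff-suc-suc zero    e n       = refl
coeff-suc-suc (suc zero)    e zero    = sym (ℕ.+-identityʳ _)
coeff-suc-suc (suc (suc a)) e zero    = refl
coeff-suc-suc (suc a) e (suc n) = coeff-suc-suc a e n

coeff-suc-zero : ∀ a e → coeff a (suc e) 0 ≡ coeff a e 0
coeff-suc-zero zero    e = refl
coeff-suc-zero (suc a) e = refl

coeff-0-1 : ∀ n → coeff 0 1 n ≡ 1
coeff-0-1 zero    = refl
coeff-0-1 (suc n) = coeff-0-1 n

-- The two recurrences of coeff 0 (suc e) n = C(n + e, e) in its arguments.
mutual
  coeff-step-n : ∀ e n → coeff 0 (suc e) (suc n) * suc n ≡ coeff 0 (suc e) n * (suc n + e)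
  coeff-step-n zero    n rewrite coeff-0-1 n = cong (_+ 0) (sym (ℕ.+-identityʳ _))
  coeff-step-n (suc e) n = begin
    (x + y) * suc n                                  ≡⟨ ℕ.*-distribʳ-+ (suc n) x y ⟩
    x * suc n + y * suc n
      -- Pascal's rule has split the entry; the two recurrences for e then say that `x * suc n` and
      -- `y * suc e` both equal `coeff 0 (suc e) n * (suc n + e)`.
      ≡⟨ cong (_+ y * suc n) (trans (coeff-step-n e n) (sym (coeff-step-e e n))) ⟩
    y * suc e + y * suc n                            ≡⟨ lemma y e n ⟩
    y * (suc n + suc e)                              ∎
    where
    open ≡-Reasoning
    x = coeff 0 (suc e) (suc n)
    y = coeff 0 (suc (suc e)) n
    lemma : ∀ y e n → y * suc e + y * suc n ≡ y * (suc n + suc e)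
    lemma = solve-∀

  coeff-step-e : ∀ e n → coeff 0 (suc (suc e)) n * suc e ≡ coeff 0 (suc e) n * (suc n + e)
  coeff-step-e e zero    = refl
  coeff-step-e e (suc n) = begin
    (x + y) * suc e              ≡⟨ ℕ.*-distribʳ-+ (suc e) x y ⟩
    x * suc e + y * suc e
      ≡⟨ cong ((x * suc e) +_) (trans (coeff-step-e e n) (sym (coeff-step-n e n))) ⟩
    x * suc e + x * suc n        ≡⟨ lemma x e n ⟩
    x * (suc (suc n) + e)        ∎
    where
    open ≡-Reasoning
    x = coeff 0 (suc e) (suc n)
    y = coeff 0 (suc (suc e)) n
    lemma : ∀ x e n → x * suc e + x * suc n ≡ x * (suc (suc n) + e)
    lemma = solve-∀

-- Functions that are eventually polynomial.

record EventuallyPolynomial {r} (f : Vector ℕ r → ℕ) : Set where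
  constructor _from_by_
  field
    polynomial : Polynomial r
    threshold  : ℕ
    -- Every coordinate is bounded below, which is the form the one-variable factors need; `min≤`
    -- derives it from a bound on `min h` at the end.
    agrees     : ∀ h → (∀ i → threshold ≤ h i) → fromℕ (f h) ≡ eval polynomial (fromℕ ∘ h)

module _ {r : ℕ} where

  const-eventually : ∀ c → EventuallyPolynomial {r} (λ _ → c)
  const-eventually c = let P , p = const-isPolynomial (fromℕ c) in
    P from 0 by λ h _ → sym (p (fromℕ ∘ h))

  +-eventually : {f g : Vector ℕ r → ℕ} → EventuallyPolynomial f → EventuallyPolynomial g →
                 EventuallyPolynomial (λ h → f h + g h)
  +-eventually {f} {g} (P from M by p) (Q from N by q) =
    (P ++ Q) from (M ℕ.⊔ N) by λ h M⊔N≤h → begin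
      fromℕ (f h + g h)                          ≡⟨ fromℕ-+ (f h) (g h) ⟩
      fromℕ (f h) ℚ.+ fromℕ (g h)
        ≡⟨ cong₂ ℚ._+_ (p h λ i → ℕ.m⊔n≤o⇒m≤o M N (M⊔N≤h i))
                       (q h λ i → ℕ.m⊔n≤o⇒n≤o M N (M⊔N≤h i)) ⟩
      eval P (fromℕ ∘ h) ℚ.+ eval Q (fromℕ ∘ h)  ≡⟨ eval-++ P Q (fromℕ ∘ h) ⟨
      eval (P ++ Q) (fromℕ ∘ h)                  ∎
    where open ≡-Reasoning

  *-eventually : {f g : Vector ℕ r → ℕ} → EventuallyPolynomial f → EventuallyPolynomial g →
                 EventuallyPolynomial (λ h → f h * g h)
  *-eventually {f} {g} (P from M by p) (Q from N by q) =
    mul P Q from (M ℕ.⊔ N) by λ h M⊔N≤h → begin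
      fromℕ (f h * g h)                          ≡⟨ fromℕ-* (f h) (g h) ⟩
      fromℕ (f h) ℚ.* fromℕ (g h)
        ≡⟨ cong₂ ℚ._*_ (p h λ i → ℕ.m⊔n≤o⇒m≤o M N (M⊔N≤h i))
                       (q h λ i → ℕ.m⊔n≤o⇒n≤o M N (M⊔N≤h i)) ⟩
      eval P (fromℕ ∘ h) ℚ.* eval Q (fromℕ ∘ h)  ≡⟨ eval-mul P Q (fromℕ ∘ h) ⟨
      eval (mul P Q) (fromℕ ∘ h)                 ∎
    where open ≡-Reasoning

-- This is (z + 1)⋯(z + e) / e!, the binomial coefficient C(z + e, e) as a polynomial in z.
coeff-polynomial : ℕ → ℚ → ℚ
coeff-polynomial zero    z = 1ℚ
coeff-polynomial (suc e) z = coeff-polynomial e z ℚ.* (z ℚ.+ fromℕ (suc e)) ℚ.* 1/1+ e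

-- Dividing `coeff-step-e` by `suc e` gives the recursion that defines `coeff-polynomial`.
coeff-polynomial-correct : ∀ e n → fromℕ (coeff 0 (suc e) n) ≡ coeff-polynomial e (fromℕ n)
coeff-polynomial-correct zero    n = cong fromℕ (coeff-0-1 n)
coeff-polynomial-correct (suc e) n = begin
  fromℕ y                                             ≡⟨ ℚ.*-identityʳ (fromℕ y) ⟨
  fromℕ y ℚ.* 1ℚ
    ≡⟨ cong (fromℕ y ℚ.*_) (trans (ℚ.*-comm (fromℕ (suc e)) (1/1+ e)) (1/1+-inverse e)) ⟨
  fromℕ y ℚ.* (fromℕ (suc e) ℚ.* 1/1+ e)
    ≡⟨ ℚ.*-assoc (fromℕ y) (fromℕ (suc e)) (1/1+ e) ⟨
  fromℕ y ℚ.* fromℕ (suc e) ℚ.* 1/1+ e                ≡⟨ cong (ℚ._* 1/1+ e) (fromℕ-* y (suc e)) ⟨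
  fromℕ (y * suc e) ℚ.* 1/1+ e
    ≡⟨ cong (λ k → fromℕ k ℚ.* 1/1+ e) (trans (coeff-step-e e n) (cong (x *_) (sym (ℕ.+-suc n e)))) ⟩
  fromℕ (x * (n + suc e)) ℚ.* 1/1+ e
    ≡⟨ cong (ℚ._* 1/1+ e) (fromℕ-* x (n + suc e)) ⟩
  fromℕ x ℚ.* fromℕ (n + suc e) ℚ.* 1/1+ e
    ≡⟨ cong₂ (λ a b → a ℚ.* b ℚ.* 1/1+ e) (coeff-polynomial-correct e n) (fromℕ-+ n (suc e)) ⟩
  coeff-polynomial (suc e) (fromℕ n)                  ∎
  where
  open ≡-Reasoning
  x = coeff 0 (suc e) n
  y = coeff 0 (suc (suc e)) n

-- Stated for a polynomial argument because zᵢ - a will be substituted.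
coeff-polynomial-isPolynomial : ∀ {r} e {f : Vector ℚ r → ℚ} → IsPolynomial f →
                                IsPolynomial (λ z → coeff-polynomial e (f z))
coeff-polynomial-isPolynomial zero    p = const-isPolynomial 1ℚ
coeff-polynomial-isPolynomial (suc e) p =
  *-isPolynomial
    (*-isPolynomial (coeff-polynomial-isPolynomial e p)
                    (+-isPolynomial p (const-isPolynomial (fromℕ (suc e)))))
    (const-isPolynomial (1/1+ e))

coeff-0-vanishes : ∀ a n → a ≤ n → coeff a 0 (suc n) ≡ 0
coeff-0-vanishes zero    n       _         = refl
coeff-0-vanishes (suc a) (suc n) (s≤s a≤n) = coeff-0-vanishes a n a≤n

coeff-shift : ∀ a e m → coeff a e (a + m) ≡ coeff 0 e m
coeff-shift zero    e m = refl
coeff-shift (suc a) e m = coeff-shift a e m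

fromℕ-∸ : ∀ a m → fromℕ (a + m) ℚ.+ ℚ.- fromℕ a ≡ fromℕ m
fromℕ-∸ a m = trans (cong (ℚ._+ ℚ.- fromℕ a) (fromℕ-+ a m))
  (solve 2 (λ a m → a :+ m :+ :- a := m) refl (fromℕ a) (fromℕ m))
  where open +-*-Solver

coeff-eventually : ∀ {r} a e (i : Fin r) → EventuallyPolynomial (λ h → coeff a e (h i))
-- With e = 0 the series is the monomial zᵃ, so the zero polynomial is right from a + 1 on.
coeff-eventually a zero    i = [] from suc a by λ h a<h → vanish (h i) (a<h i)
  where
  vanish : ∀ n → suc a ≤ n → fromℕ (coeff a 0 n) ≡ 0ℚ
  vanish (suc n) (s≤s a≤n) = cong fromℕ (coeff-0-vanishes a n a≤n)
coeff-eventually a (suc e) i =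
  -- The factor zᵃ delays the coefficients by a, hence the argument zᵢ - a; agreement starts at a,
  -- where this difference is a natural number.
  let P , p = coeff-polynomial-isPolynomial e
                (+-isPolynomial (var-isPolynomial i) (const-isPolynomial (ℚ.- fromℕ a)))
  in P from a by λ h a≤h → trans (value (h i) (a≤h i)) (sym (p (fromℕ ∘ h)))
  where
  value : ∀ n → a ≤ n → fromℕ (coeff a (suc e) n) ≡ coeff-polynomial e (fromℕ n ℚ.+ ℚ.- fromℕ a)
  value n a≤n with m , refl ← ℕ.m≤n⇒∃[o]m+o≡n a≤n = begin
    fromℕ (coeff a (suc e) (a + m))
      ≡⟨ cong fromℕ (coeff-shift a (suc e) m) ⟩
    fromℕ (coeff 0 (suc e) m)                                ≡⟨ coeff-polynomial-correct e m ⟩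
    coeff-polynomial e (fromℕ m)
      ≡⟨ cong (coeff-polynomial e) (fromℕ-∸ a m) ⟨
    coeff-polynomial e (fromℕ (a + m) ℚ.+ ℚ.- fromℕ a)       ∎
    where open ≡-Reasoning

-- Down-sets of vectors and the stabilisation of their slices.

_≤ᵛ_ : Vec ℕ k → Vec ℕ k → Set
_≤ᵛ_ = Pointwise _≤_

≤ᵛ-refl : (x : Vec ℕ k) → x ≤ᵛ x
≤ᵛ-refl x = Pointwise.refl ℕ.≤-refl

DownClosed : Pred (Vec ℕ k) ℓ → Set ℓ
DownClosed P = ∀ {x y} → x ≤ᵛ y → P y → P x

-- Only one inclusion is demanded: the slices of a down-set decrease, so for these the slices from T
-- on all coincide.
StableFrom : ℕ → Pred (Vec ℕ (suc k)) ℓ → Set ℓ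
StableFrom T P = ∀ t → T ≤ t → ∀ x → P (T ∷ x) → P (t ∷ x)

stableFrom-mono : {P : Pred (Vec ℕ (suc k)) ℓ} → DownClosed P →
                  ∀ {T U} → T ≤ U → StableFrom T P → StableFrom U P
stableFrom-mono ↓P T≤U stable t U≤t x PUx =
  stable t (ℕ.≤-trans T≤U U≤t) x (↓P (T≤U ∷ ≤ᵛ-refl x) PUx)

module _ {ℓ} (em : ExcludedMiddle ℓ) where

  -- A nested family P (t ∷ s ∷ _) is controlled by its diagonal, which is
  -- stable from some T on, and by its slices s < T.
  stabilises : (P : Pred (Vec ℕ (suc k)) ℓ) → DownClosed P → ∃[ T ] StableFrom T P
  -- With a single coordinate a slice is a truth value: if some T lies outside P, stability from T
  -- is vacuous, and otherwise P is everything.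
  stabilises {k = zero} P ↓P with em {∃[ t ] ¬ P (t ∷ [])}
  ... | yes (T , ¬PT) = T , λ { t T≤t [] PT → contradiction PT ¬PT }
  ... | no  ¬∃        = 0 , λ { t _ [] _ → decidable-stable em λ ¬Pt → ¬∃ (t , ¬Pt) }
  stabilises {k = suc k} P ↓P = U , stable
    where
    -- Identifying the two leading coordinates, or fixing the second, leaves a down-set with one
    -- coordinate fewer, so the recursion applies to both.
    Δ : Pred (Vec ℕ (suc k)) ℓ
    Δ (t ∷ x) = P (t ∷ t ∷ x)

    diagonal : ∃[ T ] StableFrom T Δ
    diagonal = stabilises Δ λ { (t≤s ∷ x≤y) → ↓P (t≤s ∷ t≤s ∷ x≤y) }

    T = proj₁ diagonal

    slice : ℕ → Pred (Vec ℕ (suc k)) ℓ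
    slice s (t ∷ x) = P (t ∷ s ∷ x)

    ↓slice : ∀ s → DownClosed (slice s)
    ↓slice s (t≤t′ ∷ x≤y) = ↓P (t≤t′ ∷ ℕ.≤-refl ∷ x≤y)

    slices : ∀ n → ∃[ U ] (∀ s → s < n → StableFrom U (slice s))
    slices zero    = 0 , λ _ ()
    slices (suc n) with U , stableU ← slices n | V , stableV ← stabilises (slice n) (↓slice n) =
      U ℕ.⊔ V , stable
      where
      stable : ∀ s → s < suc n → StableFrom (U ℕ.⊔ V) (slice s)
      stable s s<1+n with ℕ.m<1+n⇒m<n∨m≡n s<1+n
      ... | inj₁ s<n  = stableFrom-mono (↓slice s) (ℕ.m≤m⊔n U V) (stableU s s<n)
      ... | inj₂ refl = stableFrom-mono (↓slice s) (ℕ.m≤n⊔m U V) stableV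

    U = T ℕ.⊔ proj₁ (slices T)

    stable : StableFrom U P
    stable t U≤t (s ∷ x) PUsx with ℕ.<-≤-connex s T
    ... | inj₁ s<T = stableFrom-mono (↓slice s) (ℕ.m≤n⊔m T _) (proj₂ (slices T) s s<T) t U≤t x PUsx
    ... | inj₂ T≤s =
      -- Descend from (U , s) to the diagonal point (T , T), climb the diagonal to (t ⊔ s , t ⊔ s),
      -- and descend to (t , s).
      ↓P (ℕ.m≤m⊔n t s ∷ ℕ.m≤n⊔m t s ∷ ≤ᵛ-refl x)
         (proj₂ diagonal (t ℕ.⊔ s) (ℕ.m≤n⇒m≤o⊔n t T≤s) x
           (↓P (ℕ.m≤m⊔n T _ ∷ T≤s ∷ ≤ᵛ-refl x) PUsx))

-- Generating functions as lists of terms.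

-- (aᵢ , eᵢ)ᵢ stands for the power series ∏ zᵢ^aᵢ / (1 − zᵢ)^eᵢ, whose coefficient
-- at z^h is termValue.
Term : ℕ → Set
Term R = Vector (ℕ × ℕ) R

factor : ℕ × ℕ → ℕ → ℕ
factor (a , e) = coeff a e

termValue : Term R → Vector ℕ R → ℕ
termValue τ h = ∏ (λ i → factor (τ i) (h i))

value : List (Term R) → Vector ℕ R → ℕ
value ts h = ListAction.sum (List.map (λ τ → termValue τ h) ts)

-- Degrees are functions and are compared pointwise, so resetting an entry to its old value needs
-- this lemma.
value-cong : ∀ (ts : List (Term R)) {h h′} → h ≗ h′ → value ts h ≡ value ts h′
value-cong []       h≗h′ = refl
value-cong (τ ∷ ts) h≗h′ =
  cong₂ _+_ (∏-cong λ i → cong (factor (τ i)) (h≗h′ i)) (value-cong ts h≗h′)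

value-++ : ∀ (ts us : List (Term R)) h → value (ts ++ us) h ≡ value ts h + value us h
value-++ []       us h = refl
value-++ (τ ∷ ts) us h =
  trans (cong (termValue τ h +_) (value-++ ts us h)) (sym (ℕ.+-assoc (termValue τ h) _ _))

_[_]≔_ : Vector ℕ R → Fin R → ℕ → Vector ℕ R
h [ i ]≔ n = updateAt h i (const n)

-- Multiplication of the generating function by zᵢ and by 1 / (1 − zᵢ).
shift accumulate : Fin R → Term R → Term R
shift      i τ = updateAt τ i (map₁ suc)
accumulate i τ = updateAt τ i (map₂ suc)

termValue-shift-zero : ∀ (i : Fin R) τ h → termValue (shift i τ) (h [ i ]≔ 0) ≡ 0
termValue-shift-zero zero    τ h = refl
termValue-shift-zero (suc i) τ h =
  trans (cong (factor (τ zero) (h zero) *_) (termValue-shift-zero i (tail τ) (tail h)))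
        (ℕ.*-zeroʳ (factor (τ zero) (h zero)))

termValue-shift-suc : ∀ (i : Fin R) τ h n →
  termValue (shift i τ) (h [ i ]≔ suc n) ≡ termValue τ (h [ i ]≔ n)
termValue-shift-suc zero    τ h n = refl
termValue-shift-suc (suc i) τ h n =
  cong (factor (τ zero) (h zero) *_) (termValue-shift-suc i (tail τ) (tail h) n)

termValue-accumulate-zero : ∀ (i : Fin R) τ h →
  termValue (accumulate i τ) (h [ i ]≔ 0) ≡ termValue τ (h [ i ]≔ 0)
termValue-accumulate-zero zero    τ h =
  cong (_* termValue (tail τ) (tail h)) (coeff-suc-zero (proj₁ (τ zero)) (proj₂ (τ zero)))
termValue-accumulate-zero (suc i) τ h =
  cong (factor (τ zero) (h zero) *_) (termValue-accumulate-zero i (tail τ) (tail h))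

-- Only the factor at i changes, where `coeff-suc-suc` applies; distributivity carries the sum past
-- the other factors.
termValue-accumulate-suc : ∀ (i : Fin R) τ h n →
  termValue (accumulate i τ) (h [ i ]≔ suc n) ≡
  termValue τ (h [ i ]≔ suc n) + termValue (accumulate i τ) (h [ i ]≔ n)
termValue-accumulate-suc zero    τ h n =
  trans (cong (_* termValue (tail τ) (tail h)) (coeff-suc-suc (proj₁ (τ zero)) (proj₂ (τ zero)) n))
        (ℕ.*-distribʳ-+ (termValue (tail τ) (tail h)) (factor (τ zero) (suc n)) _)
termValue-accumulate-suc (suc i) τ h n =
  trans (cong (factor (τ zero) (h zero) *_) (termValue-accumulate-suc i (tail τ) (tail h) n))
        (ℕ.*-distribˡ-+ (factor (τ zero) (h zero)) (termValue (tail τ) _) _)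

module _ (i : Fin R) (h : Vector ℕ R) where

  value-shift-zero : ∀ ts → value (List.map (shift i) ts) (h [ i ]≔ 0) ≡ 0
  value-shift-zero []       = refl
  value-shift-zero (τ ∷ ts) = cong₂ _+_ (termValue-shift-zero i τ h) (value-shift-zero ts)

  value-shift-suc : ∀ ts n →
    value (List.map (shift i) ts) (h [ i ]≔ suc n) ≡ value ts (h [ i ]≔ n)
  value-shift-suc []       n = refl
  value-shift-suc (τ ∷ ts) n = cong₂ _+_ (termValue-shift-suc i τ h n) (value-shift-suc ts n)

  value-accumulate-zero : ∀ ts →
    value (List.map (accumulate i) ts) (h [ i ]≔ 0) ≡ value ts (h [ i ]≔ 0)
  value-accumulate-zero []       = refl
  value-accumulate-zero (τ ∷ ts) =
    cong₂ _+_ (termValue-accumulate-zero i τ h) (value-accumulate-zero ts)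

  value-accumulate-suc : ∀ ts n →
    value (List.map (accumulate i) ts) (h [ i ]≔ suc n) ≡
    value ts (h [ i ]≔ suc n) + value (List.map (accumulate i) ts) (h [ i ]≔ n)
  value-accumulate-suc []       n = refl
  value-accumulate-suc (τ ∷ ts) n =
    trans (cong₂ _+_ (termValue-accumulate-suc i τ h n) (value-accumulate-suc ts n))
          (+-interchange (termValue τ (h [ i ]≔ suc n)) _ _ _)

-- The constant series 1, which counts the single vector of length 0.
one : Term R
one = replicate _ (0 , 0)

termValue-one-origin : ∀ (h : Vector ℕ R) → (∀ i → h i ≡ 0) → termValue one h ≡ 1
termValue-one-origin {zero}  h h≗0 = refl
termValue-one-origin {suc R} h h≗0 rewrite h≗0 zero =
  trans (ℕ.+-identityʳ _) (termValue-one-origin (tail h) (h≗0 ∘ suc))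

termValue-one-elsewhere : ∀ (h : Vector ℕ R) → ¬ (∀ i → h i ≡ 0) → termValue one h ≡ 0
termValue-one-elsewhere {zero}  h h≢0 = contradiction (λ ()) h≢0
termValue-one-elsewhere {suc R} h h≢0 with h zero in eq
... | suc _ = refl
... | zero  = trans (ℕ.+-identityʳ _)
  (termValue-one-elsewhere (tail h) λ h≗0 → h≢0 λ { zero → eq ; (suc i) → h≗0 i })

-- Enumeration of the vectors of a given multidegree.

deg : Vec (Fin R) k → Vec ℕ k → Vector ℕ R
deg []      []      = replicate _ 0
-- A colour names the summand a coordinate draws from; the degree counts how many elements come from
-- each summand.
deg (i ∷ c) (t ∷ x) = updateAt (deg c x) i (t +_)

bump : Vec ℕ (suc k) → Vec ℕ (suc k)
bump (t ∷ x) = suc t ∷ x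

-- Lists the t ∷ x with x in `G s` and t + s = n. Separating t = 0 from the bumped rest mirrors the
-- recurrence of 1 / (1 - zᵢ).
splits : (ℕ → List (Vec ℕ k)) → ℕ → List (Vec ℕ (suc k))
splits G zero    = List.map (0 ∷_) (G 0)
splits G (suc n) = List.map (0 ∷_) (G (suc n)) ++ List.map bump (splits G n)

ofDegree : Vec (Fin R) k → Vector ℕ R → List (Vec ℕ k)
ofDegree []      h with Fin.all? (λ i → h i ℕ.≟ 0)
... | yes _ = [] ∷ []
... | no  _ = []
-- The first coordinate takes part of `h i` and leaves s of it to the other coordinates; the other
-- colours are untouched.
ofDegree (i ∷ c) h = splits (λ s → ofDegree c (h [ i ]≔ s)) (h i)

∈-splits⁺ : ∀ (G : ℕ → List (Vec ℕ k)) t s {x} → x ∈ˡ G s → (t ∷ x) ∈ˡ splits G (t + s)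
∈-splits⁺ G zero    zero    x∈G = ∈-map⁺ (0 ∷_) x∈G
∈-splits⁺ G zero    (suc s) x∈G = ∈-++⁺ˡ (∈-map⁺ (0 ∷_) x∈G)
∈-splits⁺ G (suc t) s       x∈G = ∈-++⁺ʳ _ (∈-map⁺ bump (∈-splits⁺ G t s x∈G))

∈-splits⁻ : ∀ (G : ℕ → List (Vec ℕ k)) n {t x} → (t ∷ x) ∈ˡ splits G n → ∃[ s ] t + s ≡ n × x ∈ˡ G s
∈-splits⁻ G zero    m with _ , x∈G , refl ← ∈-map⁻ (0 ∷_) m = 0 , refl , x∈G
∈-splits⁻ G (suc n) m with ∈-++⁻ (List.map (0 ∷_) (G (suc n))) m
... | inj₁ m₀ with _ , x∈G , refl ← ∈-map⁻ (0 ∷_) m₀ = suc n , refl , x∈G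
... | inj₂ m₁ with _ ∷ _ , m′ , refl ← ∈-map⁻ bump m₁ with s , eq , x∈G ← ∈-splits⁻ G n m′ =
  s , cong suc eq , x∈G

splits-unique : ∀ (G : ℕ → List (Vec ℕ k)) → (∀ s → Unique (G s)) → ∀ n → Unique (splits G n)
splits-unique G G! zero    = Unique.map⁺ (λ { refl → refl }) (G! 0)
splits-unique G G! (suc n) = Unique.++⁺
  (Unique.map⁺ (λ { refl → refl }) (G! (suc n)))
  (Unique.map⁺ (λ { {_ ∷ _} {_ ∷ _} refl → refl }) (splits-unique G G! n))
  disjoint
  where
  disjoint : ∀ {v} → ¬ (v ∈ˡ List.map (0 ∷_) (G (suc n)) × v ∈ˡ List.map bump (splits G n))
  disjoint (m₀ , m₁) with ∈-map⁻ (0 ∷_) m₀ | ∈-map⁻ bump m₁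
  ... | _ , _ , refl | (_ ∷ _) , _ , ()

ofDegree-unique : ∀ (c : Vec (Fin R) k) h → Unique (ofDegree c h)
ofDegree-unique []      h with Fin.all? (λ i → h i ℕ.≟ 0)
... | yes _ = [] ∷ []
... | no  _ = []
ofDegree-unique (i ∷ c) h = splits-unique _ (λ s → ofDegree-unique c (h [ i ]≔ s)) (h i)

∈-ofDegree⁺ : ∀ (c : Vec (Fin R) k) {x h} → deg c x ≗ h → x ∈ˡ ofDegree c h
∈-ofDegree⁺ []      {[]} {h} eq with Fin.all? (λ i → h i ℕ.≟ 0)
... | yes _   = here refl
... | no  h≢0 = contradiction (λ i → sym (eq i)) h≢0
∈-ofDegree⁺ (i ∷ c) {t ∷ x} {h} eq =
  subst (λ n → (t ∷ x) ∈ˡ splits (λ s → ofDegree c (h [ i ]≔ s)) n)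
        (trans (sym (updateAt-updates i (deg c x))) (eq i))
        (∈-splits⁺ _ t (deg c x i) (∈-ofDegree⁺ c rest))
  where
  rest : deg c x ≗ h [ i ]≔ deg c x i
  rest j with j Fin.≟ i
  ... | yes refl = sym (updateAt-updates i h)
  ... | no  j≢i  = begin
    deg c x j                    ≡⟨ updateAt-minimal j i (deg c x) j≢i ⟨
    deg (i ∷ c) (t ∷ x) j        ≡⟨ eq j ⟩
    h j                          ≡⟨ updateAt-minimal j i h j≢i ⟨
    (h [ i ]≔ deg c x i) j       ∎
    where open ≡-Reasoning

∈-ofDegree⁻ : ∀ (c : Vec (Fin R) k) {x h} → x ∈ˡ ofDegree c h → deg c x ≗ h
∈-ofDegree⁻ []      {[]} {h} m with Fin.all? (λ i → h i ℕ.≟ 0)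
... | yes h≗0 = λ i → sym (h≗0 i)
∈-ofDegree⁻ (i ∷ c) {t ∷ x} {h} m j
  with s , t+s≡hi , x∈ ← ∈-splits⁻ _ (h i) m with ∈-ofDegree⁻ c x∈ | j Fin.≟ i
... | eq | yes refl = begin
  updateAt (deg c x) i (t +_) i  ≡⟨ updateAt-updates i (deg c x) ⟩
  t + deg c x i                  ≡⟨ cong (t +_) (trans (eq i) (updateAt-updates i h)) ⟩
  t + s                          ≡⟨ t+s≡hi ⟩
  h i                            ∎
  where open ≡-Reasoning
... | eq | no  j≢i  = begin
  updateAt (deg c x) i (t +_) j  ≡⟨ updateAt-minimal j i (deg c x) j≢i ⟩
  deg c x j                      ≡⟨ eq j ⟩
  (h [ i ]≔ s) j                 ≡⟨ updateAt-minimal j i h j≢i ⟩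
  h j                            ∎
  where open ≡-Reasoning

-- Counting a down-set by degree.

module Counting {ℓ} (em : ExcludedMiddle ℓ) where

  # : ∀ {A : Set} → Pred A ℓ → List A → ℕ
  # P xs = length (filter (λ x → em {P x}) xs)

  #-cong : ∀ {A : Set} {P Q : Pred A ℓ} → P ≐ Q → ∀ xs → # P xs ≡ # Q xs
  #-cong P≐Q xs = cong length (List.filter-≐ (λ _ → em) (λ _ → em) P≐Q xs)

  #-++ : ∀ {A : Set} (P : Pred A ℓ) xs ys → # P (xs ++ ys) ≡ # P xs + # P ys
  #-++ P xs ys = trans (cong length (List.filter-++ (λ _ → em) xs ys)) (List.length-++ (filter (λ _ → em) xs))

  #-map : ∀ {A B : Set} (P : Pred B ℓ) (f : A → B) xs → # P (List.map f xs) ≡ # (P ∘ f) xs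
  #-map P f []       = refl
  #-map P f (x ∷ xs) with does (em {P (f x)})
  ... | true  = cong suc (#-map P f xs)
  ... | false = #-map P f xs

  #-splits-suc : ∀ (P : Pred (Vec ℕ (suc k)) ℓ) G n →
                 # P (splits G (suc n)) ≡ # (P ∘ (0 ∷_)) (G (suc n)) + # (P ∘ bump) (splits G n)
  #-splits-suc P G n = trans (#-++ P (List.map (0 ∷_) (G (suc n))) _)
    (cong₂ _+_ (#-map P (0 ∷_) (G (suc n))) (#-map P bump (splits G n)))

  -- Expresses that the terms sum to the generating function of P, graded by degree.
  Counts : List (Term R) → Vec (Fin R) k → Pred (Vec ℕ k) ℓ → Set
  Counts ts c P = ∀ h → # P (ofDegree c h) ≡ value ts h

  module _ {R k} (i : Fin R) (c : Vec (Fin R) k) (h : Vector ℕ R) where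

    G : ℕ → List (Vec ℕ k)
    G s = ofDegree c (h [ i ]≔ s)

    -- With equal slices the first coordinate is free, which contributes the factor 1 / (1 - zᵢ). P
    -- varies in the induction: `P ∘ bump` again has all slices equal to `P₀`.
    #-splits-constant : ∀ ts P₀ → Counts ts c P₀ →
      ∀ (P : Pred (Vec ℕ (suc k)) ℓ) → (∀ t → P₀ ≐ P ∘ (t ∷_)) →
      ∀ n → # P (splits G n) ≡ value (List.map (accumulate i) ts) (h [ i ]≔ n)
    #-splits-constant ts P₀ counts P P₀≐P zero = begin
      # P (List.map (0 ∷_) (G 0))                           ≡⟨ #-map P (0 ∷_) (G 0) ⟩
      # (P ∘ (0 ∷_)) (G 0)                                  ≡⟨ #-cong (P₀≐P 0) (G 0) ⟨
      # P₀ (G 0)                                            ≡⟨ counts _ ⟩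
      value ts (h [ i ]≔ 0)                                 ≡⟨ value-accumulate-zero i h ts ⟨
      value (List.map (accumulate i) ts) (h [ i ]≔ 0)       ∎
      where open ≡-Reasoning
    #-splits-constant ts P₀ counts P P₀≐P (suc n) = begin
      # P (splits G (suc n))                                ≡⟨ #-splits-suc P G n ⟩
      # (P ∘ (0 ∷_)) (G (suc n)) + # (P ∘ bump) (splits G n)
        ≡⟨ cong₂ _+_ (trans (sym (#-cong (P₀≐P 0) (G (suc n)))) (counts _))
                     (#-splits-constant ts P₀ counts (P ∘ bump) (λ t → P₀≐P (suc t)) n) ⟩
      value ts (h [ i ]≔ suc n) + value (List.map (accumulate i) ts) (h [ i ]≔ n)
        ≡⟨ value-accumulate-suc i h ts n ⟨
      value (List.map (accumulate i) ts) (h [ i ]≔ suc n)   ∎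
      where open ≡-Reasoning

  -- Slices before T contribute zᵢᵗ times their own generating function; from T on
  -- the slices are equal, and together contribute zᵢᵀ / (1 − zᵢ) times it.
  #-splits-stable : ∀ (i : Fin R) (c : Vec (Fin R) k) T (P : Pred (Vec ℕ (suc k)) ℓ) →
    DownClosed P → StableFrom T P → (∀ t → ∃[ ts ] Counts ts c (P ∘ (t ∷_))) →
    ∃[ ts ] (∀ h n → # P (splits (λ s → ofDegree c (h [ i ]≔ s)) n) ≡ value ts (h [ i ]≔ n))
  #-splits-stable i c zero    P ↓P stable slices =
    let ts , counts = slices 0
    in List.map (accumulate i) ts , λ h → #-splits-constant i c h ts (P ∘ (0 ∷_)) counts P
         -- Stability from 0 and down-closure are the two inclusions between slice 0 and slice t.
         λ t → (λ {x} → stable t z≤n x) , (λ {x} → ↓P (z≤n ∷ ≤ᵛ-refl x))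
  #-splits-stable i c (suc T) P ↓P stable slices =
    let ts , counts = slices 0
        -- Dropping slice 0 lowers the threshold by one; `shift` restores the lost factor zᵢ.
        us , eq     = #-splits-stable i c T (P ∘ bump)
                        (λ { (t≤s ∷ x≤y) → ↓P (s≤s t≤s ∷ x≤y) })
                        (λ t T≤t → stable (suc t) (s≤s T≤t))
                        (λ t → slices (suc t))
    in ts ++ List.map (shift i) us , step ts counts us eq
    where
    step : ∀ ts → Counts ts c (P ∘ (0 ∷_)) → ∀ us →
           (∀ h n → # (P ∘ bump) (splits (λ s → ofDegree c (h [ i ]≔ s)) n) ≡ value us (h [ i ]≔ n)) →
           ∀ h n → # P (splits (λ s → ofDegree c (h [ i ]≔ s)) n) ≡
                   value (ts ++ List.map (shift i) us) (h [ i ]≔ n)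
    step ts counts us eq h zero    = begin
      # P (List.map (0 ∷_) (ofDegree c (h [ i ]≔ 0)))
        ≡⟨ #-map P (0 ∷_) (ofDegree c (h [ i ]≔ 0)) ⟩
      # (P ∘ (0 ∷_)) (ofDegree c (h [ i ]≔ 0))               ≡⟨ counts (h [ i ]≔ 0) ⟩
      value ts (h [ i ]≔ 0)                                  ≡⟨ ℕ.+-identityʳ _ ⟨
      value ts (h [ i ]≔ 0) + 0
        ≡⟨ cong (value ts (h [ i ]≔ 0) +_) (value-shift-zero i h us) ⟨
      value ts (h [ i ]≔ 0) + value (List.map (shift i) us) (h [ i ]≔ 0)
        ≡⟨ value-++ ts (List.map (shift i) us) (h [ i ]≔ 0) ⟨
      value (ts ++ List.map (shift i) us) (h [ i ]≔ 0)       ∎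
      where open ≡-Reasoning
    step ts counts us eq h (suc n) = begin
      # P (splits (λ s → ofDegree c (h [ i ]≔ s)) (suc n))   ≡⟨ #-splits-suc P _ n ⟩
      # (P ∘ (0 ∷_)) (ofDegree c (h [ i ]≔ suc n)) + # (P ∘ bump) (splits (λ s → ofDegree c (h [ i ]≔ s)) n)
        ≡⟨ cong₂ _+_ (counts (h [ i ]≔ suc n)) (trans (eq h n) (sym (value-shift-suc i h us n))) ⟩
      value ts (h [ i ]≔ suc n) + value (List.map (shift i) us) (h [ i ]≔ suc n)
        ≡⟨ value-++ ts (List.map (shift i) us) (h [ i ]≔ suc n) ⟨
      value (ts ++ List.map (shift i) us) (h [ i ]≔ suc n)   ∎
      where open ≡-Reasoning

  -- Induction on the number of coordinates: each slice is a smaller down-set, and by `stabilises`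
  -- only finitely many slices differ.
  downClosed-counts : ∀ (c : Vec (Fin R) k) (P : Pred (Vec ℕ k) ℓ) → DownClosed P →
                      ∃[ ts ] Counts ts c P
  downClosed-counts {R} [] P ↓P with em {P []}
  ... | yes P[] = one ∷ [] , inside
    where
    inside : Counts (one ∷ []) [] P
    inside h with Fin.all? (λ i → h i ℕ.≟ 0)
    ... | yes h≗0 = trans (cong length (List.filter-accept (λ _ → em) P[]))
                          (sym (trans (ℕ.+-identityʳ _) (termValue-one-origin h h≗0)))
    ... | no  h≢0 = sym (trans (ℕ.+-identityʳ _) (termValue-one-elsewhere h h≢0))
  ... | no ¬P[] = [] , outside
    where
    outside : Counts {R} [] [] P
    outside h with Fin.all? (λ i → h i ℕ.≟ 0)
    ... | yes _ = cong length (List.filter-reject (λ _ → em) ¬P[])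
    ... | no  _ = refl
  downClosed-counts (i ∷ c) P ↓P =
    let T , stable = stabilises em P ↓P
        ts , eq    = #-splits-stable i c T P ↓P stable λ t →
                       downClosed-counts c (P ∘ (t ∷_)) (λ x≤y → ↓P (ℕ.≤-refl ∷ x≤y))
    -- The slice count holds for any n in place of `h i`; taking n to be `h i` gives back h.
    in ts , λ h → trans (eq h (h i)) (value-cong ts (updateAt-id-local i h refl))

-- Eventual polynomiality of the coefficients.

∏-eventually : ∀ {r m} (f : Fin m → Vector ℕ r → ℕ) → (∀ i → EventuallyPolynomial (f i)) →
               EventuallyPolynomial (λ h → ∏ (λ i → f i h))
∏-eventually {m = zero}  f _ = const-eventually 1
∏-eventually {m = suc m} f p = *-eventually (p zero) (∏-eventually (f ∘ suc) (p ∘ suc))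

-- The leading degree stays fixed at n, so its factor is a constant however small n is; every other
-- factor depends on one variable.
value-eventually : ∀ {r} n (ts : List (Term (suc r))) →
                   EventuallyPolynomial (λ h → value ts (n Vector.∷ h))
value-eventually n []       = const-eventually 0
value-eventually n (τ ∷ ts) = +-eventually
  (*-eventually (const-eventually (factor (τ zero) n))
    (∏-eventually (λ i h → factor (τ (suc i)) (h i))
                  (λ i → coeff-eventually (proj₁ (τ (suc i))) (proj₂ (τ (suc i))) i)))
  (value-eventually n ts)

-- The lexicographic order and the additivity of the degree.

_+ᵛ_ : Vec ℕ k → Vec ℕ k → Vec ℕ k
_+ᵛ_ = zipWith _+_

_<ᵛ_ : Vec ℕ k → Vec ℕ k → Set
_<ᵛ_ = Lex-< _≡_ _<_

<ᵛ-wellFounded : WellFounded (_<ᵛ_ {k})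
<ᵛ-wellFounded = Lex.<-wellFounded trans (λ { refl p → p }) <-wellFounded

+ᵛ-monoˡ-<ᵛ : ∀ (z : Vec ℕ k) {x y} → x <ᵛ y → (x +ᵛ z) <ᵛ (y +ᵛ z)
+ᵛ-monoˡ-<ᵛ (t ∷ z) (this a<b eq)    = this (ℕ.+-monoˡ-< t a<b) refl
+ᵛ-monoˡ-<ᵛ (t ∷ z) (next refl x<y) = next refl (+ᵛ-monoˡ-<ᵛ z x<y)

≤ᵛ⇒∃+ᵛ : ∀ {x y : Vec ℕ k} → x ≤ᵛ y → ∃[ z ] x +ᵛ z ≡ y
≤ᵛ⇒∃+ᵛ []           = [] , refl
≤ᵛ⇒∃+ᵛ (a≤b ∷ x≤y) with t , refl ← ℕ.m≤n⇒∃[o]m+o≡n a≤b | z , refl ← ≤ᵛ⇒∃+ᵛ x≤y = t ∷ z , refl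

single : Fin R → ℕ → Vector ℕ R
single i n = replicate _ 0 [ i ]≔ n

single-zero : ∀ (i : Fin R) s → single i 0 s ≡ 0
single-zero i = updateAt-id-local i (replicate _ 0) refl

single-+ : ∀ (i : Fin R) m n s → single i m s + single i n s ≡ single i (m + n) s
single-+ zero    m n zero    = refl
single-+ zero    m n (suc s) = refl
single-+ (suc i) m n zero    = refl
single-+ (suc i) m n (suc s) = single-+ i m n s

∑-single : ∀ (h : Vector ℕ R) s → ∑ (λ i → single i (h i) s) ≡ h s
∑-single {suc R} h zero    = trans (cong (h zero +_) (∑-replicate-zero R)) (ℕ.+-identityʳ _)
∑-single {suc R} h (suc s) = ∑-single (tail h) s

deg-∷ : ∀ i t (c : Vec (Fin R) k) x s → deg (i ∷ c) (t ∷ x) s ≡ single i t s + deg c x s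
deg-∷ i t c x s = updateAt-+ (deg c x) i t s
  where
  updateAt-+ : ∀ {R} (h : Vector ℕ R) i t s → updateAt h i (t +_) s ≡ single i t s + h s
  updateAt-+ h zero    t zero    = refl
  updateAt-+ h zero    t (suc s) = refl
  updateAt-+ h (suc i) t zero    = refl
  updateAt-+ h (suc i) t (suc s) = updateAt-+ (tail h) i t s

deg-+ᵛ : ∀ (c : Vec (Fin R) k) x y s → deg c (x +ᵛ y) s ≡ deg c x s + deg c y s
deg-+ᵛ []      []      []      s = refl
deg-+ᵛ (i ∷ c) (t ∷ x) (u ∷ y) s = begin
  deg (i ∷ c) ((t + u) ∷ (x +ᵛ y)) s                          ≡⟨ deg-∷ i (t + u) c (x +ᵛ y) s ⟩
  single i (t + u) s + deg c (x +ᵛ y) s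
    ≡⟨ cong₂ _+_ (sym (single-+ i t u s)) (deg-+ᵛ c x y s) ⟩
  single i t s + single i u s + (deg c x s + deg c y s)
    ≡⟨ +-interchange (single i t s) _ _ _ ⟩
  single i t s + deg c x s + (single i u s + deg c y s)
    ≡⟨ cong₂ _+_ (deg-∷ i t c x s) (deg-∷ i u c y s) ⟨
  deg (i ∷ c) (t ∷ x) s + deg (i ∷ c) (u ∷ y) s               ∎
  where open ≡-Reasoning

deg-zero : ∀ (c : Vec (Fin R) k) s → deg c (Vec.replicate k 0) s ≡ 0
deg-zero []      s = refl
deg-zero (i ∷ c) s = trans (deg-∷ i 0 c _ s) (cong₂ _+_ (single-zero i s) (deg-zero c s))

-- Auxiliary facts on lists, minima and excluded middle.

lookup-injective : ∀ {a} {A : Set a} {xs : List A} → Unique xs →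
                   ∀ i j → List.lookup xs i ≡ List.lookup xs j → i ≡ j
lookup-injective (_    ∷ _)   zero    zero    _  = refl
lookup-injective (x∉xs ∷ _)   zero    (suc j) eq = contradiction eq (All.lookup x∉xs (∈-lookup j))
lookup-injective (x∉xs ∷ _)   (suc i) zero    eq = contradiction (sym eq) (All.lookup x∉xs (∈-lookup i))
lookup-injective (_    ∷ xs!) (suc i) (suc j) eq = cong suc (lookup-injective xs! i j eq)

min≤ : ∀ {r} .{{_ : NonZero r}} (h : Vector ℕ r) i → min h ≤ h i
-- `min` folds the tail starting from the head, so index zero is bounded through the initial value
-- of the fold.
min≤ {suc r} h = λ { zero → foldr-⊓-≤-init (tail h) ; (suc i) → foldr-⊓-≤ (tail h) i }
  where
  foldr-⊓-≤-init : ∀ {n x} (v : Vector ℕ n) → Vector.foldr _⊓_ x v ≤ x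
  foldr-⊓-≤-init {zero}  v = ℕ.≤-refl
  foldr-⊓-≤-init {suc n} v = ℕ.≤-trans (ℕ.m⊓n≤n (v zero) _) (foldr-⊓-≤-init (tail v))

  foldr-⊓-≤ : ∀ {n x} (v : Vector ℕ n) i → Vector.foldr _⊓_ x v ≤ v i
  foldr-⊓-≤ v zero    = ℕ.m⊓n≤m (v zero) _
  foldr-⊓-≤ v (suc i) = ℕ.≤-trans (ℕ.m⊓n≤n (v zero) _) (foldr-⊓-≤ (tail v) i)

-- Irreducibility lives at the level of the equality of S, below the joint level at which the
-- theorem assumes excluded middle.
excludedMiddle-lower : ∀ a {b} → ExcludedMiddle (a ⊔ b) → ExcludedMiddle b
excludedMiddle-lower a em {P} = map′ lower lift (em {Lift a P})

-- Irreducible representatives.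

module _ {c ℓ} (S : CommutativeMonoid c ℓ) where
  open CommutativeMonoid S renaming (refl to ≈-refl; sym to ≈-sym; trans to ≈-trans)
  open Cardinality setoid
  open Sumsets S
  open import Algebra.Properties.CommutativeMonoid.Sum S using (sum; sum-replicate-zero)
  open import Algebra.Properties.Monoid.Mult monoid using () renaming (_×_ to _⊗_; ×-homo-+ to ⊗-homo-+)
  open import Algebra.Properties.CommutativeSemigroup commutativeSemigroup using (interchange)
  import Relation.Binary.Reasoning.Setoid setoid as ≈-Reasoning

  lin : Vec Carrier k → Vec ℕ k → Carrier
  lin []      []      = ε
  lin (a ∷ v) (t ∷ x) = (t ⊗ a) ∙ lin v x

  lin-+ᵛ : ∀ (v : Vec Carrier k) x y → lin v (x +ᵛ y) ≈ lin v x ∙ lin v y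
  lin-+ᵛ []      []      []      = ≈-sym (identityˡ ε)
  lin-+ᵛ (a ∷ v) (t ∷ x) (u ∷ y) =
    ≈-trans (∙-cong (⊗-homo-+ a t u) (lin-+ᵛ v x y)) (interchange _ _ _ _)

  lin-zero : ∀ (v : Vec Carrier k) → lin v (Vec.replicate k 0) ≈ ε
  lin-zero []      = ≈-refl
  lin-zero (a ∷ v) = ≈-trans (identityˡ _) (lin-zero v)

  module _ {R k} (col : Vec (Fin R) k) (v : Vec Carrier k) where

    Reduces : Vec ℕ k → Vec ℕ k → Set ℓ
    Reduces x y = y <ᵛ x × deg col y ≗ deg col x × lin v y ≈ lin v x

    Irreducible : Pred (Vec ℕ k) ℓ
    Irreducible x = ¬ ∃ (Reduces x)

    -- If w reduces x and y = x + z, then w + z reduces y: the order is translation invariant, and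
    -- degree and image are additive.
    irreducible-downClosed : DownClosed Irreducible
    irreducible-downClosed {x} x≤y irr (w , w<x , deg≗ , lin≈)
      with z , refl ← ≤ᵛ⇒∃+ᵛ x≤y = irr (w +ᵛ z , +ᵛ-monoˡ-<ᵛ z w<x ,
        (λ s → trans (deg-+ᵛ col w z s) (trans (cong (_+ deg col z s) (deg≗ s)) (sym (deg-+ᵛ col x z s)))) ,
        ≈-trans (lin-+ᵛ v w z) (≈-trans (∙-congʳ lin≈) (≈-sym (lin-+ᵛ v x z))))

    -- The lexicographic order is total, so of two distinct candidates the smaller would reduce the
    -- larger.
    irreducible-unique : ∀ {x y} → Irreducible x → Irreducible y →
                         deg col x ≗ deg col y → lin v x ≈ lin v y → x ≡ y
    irreducible-unique {x} {y} irrx irry deg≗ lin≈ with Lex.<-cmp sym ℕ.<-cmp x y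
    ... | tri< x<y _ _   = contradiction (x , x<y , deg≗ , lin≈) irry
    ... | tri≈ _ x≡y _   = Pointwise.Pointwise-≡⇒≡ x≡y
    ... | tri> _ _ y<x   = contradiction (y , y<x , (λ s → sym (deg≗ s)) , ≈-sym lin≈) irrx

    Representable : Vector ℕ R → Pred Carrier ℓ
    Representable h s = ∃[ x ] deg col x ≗ h × s ≈ lin v x

    module _ (em : ExcludedMiddle ℓ) where
      open Counting em

      -- Reduce as long as possible; this ends because the lexicographic order on vectors of fixed
      -- length is well-founded.
      irreducible-exists : ∀ x → ∃[ y ] Irreducible y × deg col y ≗ deg col x × lin v y ≈ lin v x
      irreducible-exists x = go x (<ᵛ-wellFounded x)
        where
        go : ∀ x → Acc _<ᵛ_ x → ∃[ y ] Irreducible y × deg col y ≗ deg col x × lin v y ≈ lin v x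
        go x (acc rec) with em {∃ (Reduces x)}
        ... | no  irr = x , irr , (λ _ → refl) , ≈-refl
        ... | yes (w , w<x , deg≗ , lin≈) =
          let y , irr , deg≗′ , lin≈′ = go w (rec w<x)
          in y , irr , (λ s → trans (deg≗′ s) (deg≗ s)) , ≈-trans lin≈′ lin≈

      -- `lin v` maps the irreducible vectors of degree h bijectively onto X: injectivity is
      -- uniqueness, surjectivity is existence of irreducible representatives.
      representable-card : ∀ {q} {X : Pred Carrier q} h →
        (∀ x → deg col x ≗ h → X (lin v x)) → (∀ {s} → X s → Representable h s) →
        HasCard X (# Irreducible (ofDegree col h))
      representable-card {X = X} h sound complete = record
        { to        = λ i → lin v (at i) , sound (at i) (at-deg i)
        ; cong      = λ { refl → ≈-refl }
        ; bijective = injective , surjective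
        }
        where
        L = filter (λ x → em {Irreducible x}) (ofDegree col h)

        at : Fin (length L) → Vec ℕ k
        at = List.lookup L

        at-deg : ∀ i → deg col (at i) ≗ h
        at-deg i = ∈-ofDegree⁻ col
          (proj₁ (∈-filter⁻ (λ x → em {Irreducible x}) {xs = ofDegree col h} (∈-lookup i)))

        at-irreducible : ∀ i → Irreducible (at i)
        at-irreducible i =
          proj₂ (∈-filter⁻ (λ x → em {Irreducible x}) {xs = ofDegree col h} (∈-lookup i))

        injective : ∀ {i j} → lin v (at i) ≈ lin v (at j) → i ≡ j
        injective {i} {j} eq = lookup-injective
          (Unique.filter⁺ (λ x → em {Irreducible x}) (ofDegree-unique col h)) i j
          (irreducible-unique (at-irreducible i) (at-irreducible j)
            (λ s → trans (at-deg i s) (sym (at-deg j s))) eq)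

        surjective : ∀ (y : ∃ X) → ∃[ i ] (∀ {j} → j ≡ i → lin v (at j) ≈ proj₁ y)
        surjective (s , s∈X) =
          let x , deg≗ , s≈       = complete s∈X
              y , irr , deg≗′ , lin≈ = irreducible-exists x
              y∈L = ∈-filter⁺ (λ x → em {Irreducible x})
                      (∈-ofDegree⁺ col λ j → trans (deg≗′ j) (deg≗ j)) irr
          in Any.index y∈L , λ { refl →
               ≈-trans (reflexive (cong (lin v) (sym (Any.lookup-index y∈L)))) (≈-trans lin≈ (≈-sym s≈)) }

    -- Sums of representable elements.

    representable-resp : ∀ {h h′ s s′} → h ≗ h′ → s′ ≈ s → Representable h s → Representable h′ s′
    representable-resp h≗h′ s′≈s (x , deg≗ , s≈) =
      x , (λ j → trans (deg≗ j) (h≗h′ j)) , ≈-trans s′≈s s≈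

    representable-ε : Representable (replicate R 0) ε
    representable-ε = Vec.replicate k 0 , deg-zero col , ≈-sym (lin-zero v)

    representable-∙ : ∀ {h h′ s s′} → Representable h s → Representable h′ s′ →
                      Representable (λ j → h j + h′ j) (s ∙ s′)
    representable-∙ (x , deg≗ , s≈) (y , deg≗′ , s′≈) =
      x +ᵛ y , (λ j → trans (deg-+ᵛ col x y j) (cong₂ _+_ (deg≗ j) (deg≗′ j))) ,
      ≈-trans (∙-cong s≈ s′≈) (≈-sym (lin-+ᵛ v x y))

    representable-sum : ∀ {n} (H : Fin n → Vector ℕ R) (u : Vector Carrier n) →
                        (∀ i → Representable (H i) (u i)) →
                        Representable (λ j → ∑ (λ i → H i j)) (sum u)
    representable-sum {zero}  H u rep = representable-ε
    representable-sum {suc n} H u rep =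
      representable-∙ (rep zero) (representable-sum (H ∘ suc) (tail u) (rep ∘ suc))

    representable-· : ∀ {p} {A : Pred Carrier p} i → (∀ {a} → a ∈ A → Representable (single i 1) a) →
                      ∀ n {s} → s ∈ n · A → Representable (single i n) s
    representable-· i gen zero    (a , a∈A , s≈) =
      representable-resp (λ j → sym (single-zero i j)) s≈ representable-ε
    representable-· i gen (suc n) (a , a∈A , s≈) =
      representable-resp (single-+ i 1 n) s≈
        (representable-∙ (gen (a∈A zero))
          (representable-· i gen n (tail a , a∈A ∘ suc , ≈-refl)))

  -- The generators and the sums they produce.

  ⊗∙-∈-· : ∀ {p} {A : Pred Carrier p} {a} → a ∈ A → ∀ t {n w} → w ∈ n · A → ((t ⊗ a) ∙ w) ∈ (t + n) · A
  ⊗∙-∈-· a∈A zero    (b , b∈A , w≈) = b , b∈A , ≈-trans (identityˡ _) w≈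
  ⊗∙-∈-· {a = a} a∈A (suc t) w∈ =
    let b , b∈A , eq = ⊗∙-∈-· a∈A t w∈
    in a Vector.∷ b , (λ { zero → a∈A ; (suc j) → b∈A j }) , ≈-trans (assoc _ _ _) (∙-congˡ eq)

  module _ {p R} (A : Vector (Pred Carrier p) R) where

    colours : (g : List (Fin R × Carrier)) → Vec (Fin R) (length g)
    colours g = Vec.map proj₁ (Vec.fromList g)

    elements : (g : List (Fin R × Carrier)) → Vec Carrier (length g)
    elements g = Vec.map proj₂ (Vec.fromList g)

    -- Groups a combination by colour: t copies of a generator of colour i enter the i-th summand
    -- and leave the others alone.
    lin∈sumset : ∀ {g} → All (λ (i , a) → a ∈ A i) g → ∀ x →
                 ∃[ u ] (∀ i → u i ∈ deg (colours g) x i · A i) × lin (elements g) x ≈ sum u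
    lin∈sumset []                        []      =
      replicate R ε , (λ i → (λ ()) , (λ ()) , ≈-refl) , ≈-sym (sum-replicate-zero R)
    lin∈sumset {(i , a) ∷ g} (a∈A ∷ g∈A) (t ∷ x) =
      let u , u∈ , eq = lin∈sumset g∈A x
      in updateAt u i ((t ⊗ a) ∙_) , member u u∈ ,
         ≈-trans (∙-congˡ eq) (≈-sym (sum-updateAt S u i (t ⊗ a)))
      where
      member : ∀ u → (∀ j → u j ∈ deg (colours g) x j · A j) →
               ∀ j → updateAt u i ((t ⊗ a) ∙_) j ∈ updateAt (deg (colours g) x) i (t +_) j · A j
      member u u∈ j with j Fin.≟ i
      ... | yes refl = subst₂ (λ s n → s ∈ n · A i)
        (sym (updateAt-updates i u)) (sym (updateAt-updates i (deg (colours g) x)))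
        (⊗∙-∈-· a∈A t (u∈ i))
      ... | no  j≢i  = subst₂ (λ s n → s ∈ n · A j)
        (sym (updateAt-minimal j i u j≢i)) (sym (updateAt-minimal j i (deg (colours g) x) j≢i))
        (u∈ j)

    -- The witness is the unit vector at the position where the generator occurs.
    generator-representable : ∀ {i a g} → Any (λ (j , b) → i ≡ j × a ≈ b) g →
                              Representable (colours g) (elements g) (single i 1) a
    generator-representable {i} {a} {(i , b) ∷ g} (here (refl , a≈b)) =
      1 ∷ Vec.replicate _ 0 ,
      (λ j → trans (deg-∷ i 1 (colours g) _ j)
               (trans (cong (single i 1 j +_) (deg-zero (colours g) j)) (ℕ.+-identityʳ _))) ,
      (begin
        a                                             ≈⟨ a≈b ⟩
        b                                             ≈⟨ identityʳ b ⟨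
        b ∙ ε
          ≈⟨ ∙-cong (identityʳ b) (lin-zero (elements g)) ⟨
        (b ∙ ε) ∙ lin (elements g) (Vec.replicate _ 0)  ∎)
      where open ≈-Reasoning
    generator-representable {g = (j , b) ∷ g} (there a∈g) =
      let x , deg≗ , a≈ = generator-representable a∈g
      in 0 ∷ x ,
         (λ s → trans (updateAt-id-local j (deg (colours g) x) refl s) (deg≗ s)) ,
         ≈-trans a≈ (≈-sym (identityˡ _))

    -- Elements carry their colour, so one that lies in several of the sets is listed for each of
    -- them.
    generators : (∀ i → Finite (A i)) → List (Fin R × Carrier)
    generators fin = List.concat (List.tabulate λ i →
      List.tabulate λ j → i , proj₁ (Bijection.to (proj₂ (fin i)) j))

    generators-sound : ∀ fin → All (λ (i , a) → a ∈ A i) (generators fin)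
    generators-sound fin = All.concat⁺ (All.tabulate⁺ λ i →
      All.tabulate⁺ λ j → proj₂ (Bijection.to (proj₂ (fin i)) j))

    generators-complete : ∀ fin i {a} → a ∈ A i → Any (λ (j , b) → i ≡ j × a ≈ b) (generators fin)
    generators-complete fin i {a} a∈A =
      let j , eq = Bijection.surjective (proj₂ (fin i)) (a , a∈A)
      in Any.concat⁺ (Any.tabulate⁺ i (Any.tabulate⁺ j (refl , ≈-sym (eq refl))))

mainTheorem1 :
    ∀ {c ℓ p} → ExcludedMiddle (c ⊔ ℓ ⊔ p) →
    (S : CommutativeMonoid c ℓ) →
    let open CommutativeMonoid S
        open Cardinality setoid
        open Sumsets S in
    (r : ℕ) .{{_ : NonZero r}} →
    (A : Vector (Pred Carrier p) r) (B : Pred Carrier p) →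
    (∀ i → A i Respects _≈_) → B Respects _≈_ →
    (∀ i → Finite (A i)) → Finite B →
    (∀ i → Satisfiable (A i)) → Satisfiable B →
    Σ[ P ∈ Polynomial r ] Σ[ N ∈ ℕ ] ((h : Vector ℕ r) → N ≤ min h →
      Σ[ n ∈ ℕ ] HasCard (sumset B h A) n × fromℕ n ≡ eval P (λ i → fromℕ (h i)))
mainTheorem1 {c} {ℓ} {p} em S r A B _ _ finA finB _ _ =
  -- One generating function covers all degrees, so P and N are fixed before h is given.
  let ts , counts = downClosed-counts col Irr (irreducible-downClosed S col v)
      P from N by eq = value-eventually 1 ts
  in P , N , λ h N≤min →
     # Irr (ofDegree col (1 Vector.∷ h)) ,
     representable-card S col v em′ (1 Vector.∷ h) (sound h) (complete h) ,
     trans (cong fromℕ (counts (1 Vector.∷ h))) (eq h λ i → ℕ.≤-trans N≤min (min≤ h i))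
  where
  open CommutativeMonoid S renaming (refl to ≈-refl; sym to ≈-sym; trans to ≈-trans)
  open Cardinality setoid
  open Sumsets S

  em′ : ExcludedMiddle ℓ
  em′ = excludedMiddle-lower (c ⊔ p) em

  open Counting em′

  BA : Vector (Pred Carrier p) (suc r)
  BA = B Vector.∷ A

  fin : ∀ i → Finite (BA i)
  fin zero    = finB
  fin (suc i) = finA i

  g   = generators S BA fin
  col = colours S BA g
  v   = elements S BA g
  Irr = Irreducible S col v

  sound : ∀ h x → deg col x ≗ 1 Vector.∷ h → sumset B h A (lin S v x)
  sound h x deg≗ =
    let u , u∈ , eq     = lin∈sumset S BA (generators-sound S BA fin) x
        -- Degree 1 in colour zero makes this summand a one-term sum: a single element of B plus the
        -- identity.
        b , b∈B , u₀≈b  = subst (λ n → u zero ∈ n · B) (deg≗ zero) (u∈ zero)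
    in b zero , tail u , b∈B zero ,
       (λ i → subst (λ n → u (suc i) ∈ n · A i) (deg≗ (suc i)) (u∈ (suc i))) ,
       ≈-trans eq (∙-congʳ (≈-trans u₀≈b (identityʳ _)))

  gen : ∀ i {a} → a ∈ BA i → Representable S col v (single i 1) a
  gen i a∈ = generator-representable S BA (generators-complete S BA fin i a∈)

  complete : ∀ h {s} → sumset B h A s → Representable S col v (1 Vector.∷ h) s
  complete h (b , u , b∈B , u∈ , s≈) =
    -- One element of colour zero and `h i` elements of each colour `suc i` have total degree (1 ,
    -- h).
    representable-resp S col v (∑-single (1 Vector.∷ h)) s≈
      (representable-sum S col v (λ i → single i ((1 Vector.∷ h) i)) (b Vector.∷ u) λ
        { zero    → gen zero b∈B
        ; (suc i) → representable-· S col v (suc i) (gen (suc i)) (h i) (u∈ i) })
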